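{- Let $k\ge1$, let $\vec s=(n_1,\dots,n_k)$ be a tuple of positive integers, $p\ge1$ and $0\le j\le p$. An index $m=(m_1,\dots,m_k)\in I_p$ is missing from the $(p,j)$-horn (i.e. $m\in M_{p,j}$) if and only if $\operatorname{im}(m)\supseteq F_j$, where $\operatorname{im}(m)=\{m_1,\dots,m_k\}$ and $F_j=\{0,\dots,p\}\setminus\{j\}$.
   Context: Notation: $[p]=\{0,\dots,p\}$. For a shape $\vec s=(n_1,\dots,n_k)$ put $n=\min(n_1,\dots,n_k)-1$, $M_a(p)=n_a-1-n+p$ (so $M_a(p)\ge p$) and $I_p=\prod_{a=1}^k[M_a(p)]$ for $p\ge 0$. Let $\delta_i^q:[q-1]\to[q]$ be the increasing injection missing $i$, and $\Delta_i^p=\prod_{a=1}^k\delta_i^{M_a(p)}:I_{p-1}\to I_p$ ($p\ge1$, $0\le i\le p$). An index $m\in I_p$ is missing from the $(p,j)$-horn if $m\notin\operatorname{im}(\Delta_i^p)$ for all $i\in F_j$; $M_{p,j}\subset I_p$ denotes the set of missing indices. -}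

module Defs where

open import Data.Nat using (ℕ; suc; pred; _+_; _∸_; _⊓_; _≤_; NonZero)
open import Data.Fin using (Fin; toℕ; punchIn; _↑ˡ_)
open import Data.Vec using (Vec; lookup; foldr₁)
open import Data.Product using (∃; _×_)
open import Relation.Binary.PropositionalEquality using (_≡_; _≢_)
open import Relation.Unary using (Pred; _∈_; _∉_)
open import Level using (0ℓ)

-- Throughout, [p] = {0,…,p} is Fin (suc p).

minimum : ∀ {k} .{{_ : NonZero k}} → Vec ℕ k → ℕ
minimum {suc k} s = foldr₁ _⊓_ s

dim : ∀ {k} .{{_ : NonZero k}} → Vec ℕ k → ℕ
dim s = minimum s ∸ 1

-- n_a - 1 - n.  For positive entries neither subtraction truncates.
excess : ∀ {k} .{{_ : NonZero k}} → Vec ℕ k → Fin k → ℕ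
excess s a = lookup s a ∸ 1 ∸ dim s

-- The summand p comes first so that M s a (suc p) reduces to suc (M s a p).
M : ∀ {k} .{{_ : NonZero k}} → Vec ℕ k → Fin k → ℕ → ℕ
M s a p = p + excess s a

I : ∀ {k} .{{_ : NonZero k}} → Vec ℕ k → ℕ → Set
I {k} s p = (a : Fin k) → Fin (suc (M s a p))

-- punchIn i is the increasing injection whose image omits exactly i.
δ : ∀ q .{{_ : NonZero q}} → Fin (suc q) → Fin (suc (pred q)) → Fin (suc q)
δ (suc q) i = punchIn i

-- i ↑ˡ excess s a is i viewed in [M s a p], with the same numerical value.
Δ : ∀ {k} .{{_ : NonZero k}} (s : Vec ℕ k) p .{{_ : NonZero p}} →
    Fin (suc p) → I s (pred p) → I s p
Δ s (suc p) i m a = δ (M s a (suc p)) (i ↑ˡ excess s a) (m a)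

-- Tuples are functions here, so equality of tuples is equality of all
-- components (propositional equality of functions would be too strict).
imΔ : ∀ {k} .{{_ : NonZero k}} (s : Vec ℕ k) p .{{_ : NonZero p}} →
      Fin (suc p) → Pred (I s p) 0ℓ
imΔ s p i m = ∃ λ (m′ : I s (pred p)) → ∀ a → Δ s p i m′ a ≡ m a

-- F j and im m are sets of natural numbers: the components of m range over
-- intervals of different lengths, possibly beyond p.
F : ∀ {p} → Fin (suc p) → Pred ℕ 0ℓ
F {p} j i = i ≤ p × i ≢ toℕ j

im : ∀ {k} {N : Fin k → ℕ} → ((a : Fin k) → Fin (N a)) → Pred ℕ 0ℓ
im m i = ∃ λ a → toℕ (m a) ≡ i

Missing : ∀ {k} .{{_ : NonZero k}} (s : Vec ℕ k) p .{{_ : NonZero p}} →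
          Fin (suc p) → Pred (I s p) 0ℓ
Missing s p j m = ∀ (i : Fin (suc p)) → toℕ i ∈ F j → m ∉ imΔ s p i

{-# OPTIONS --safe #-}
module Submission where

open import Defs
open import Data.Nat using (ℕ; suc; NonZero; s≤s; _≟_)
open import Data.Fin using (Fin; toℕ; fromℕ<; punchOut; _↑ˡ_)
open import Data.Fin.Properties
  using (toℕ-↑ˡ; toℕ-injective; toℕ-fromℕ<; punchIn-punchOut; punchInᵢ≢i; any?)
open import Data.Vec using (Vec)
open import Data.Vec.Relation.Unary.All using (All)
open import Data.Product using (_,_)
open import Function.Bundles using (_⇔_; mk⇔; Equivalence)
open import Relation.Binary.PropositionalEquality using (_≡_; sym; trans; cong; subst)
open import Relation.Nullary using (yes; no; contradiction)
open import Relation.Unary using (_∈_; _∉_; _⊇_)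

-- Each coset-free factor `δ` is a bijection onto the complement of one value, so the image of
-- `Δ s p i` is the set of tuples with no component equal to `i` (`∈imΔ⇔∉im`). Hence `m` is missing
-- iff no `i` in `F j` lies outside `im m`. As `m` has finitely many components, membership in
-- `im m` is decidable and the double negation disappears.

∈imΔ⇔∉im : ∀ {k} .{{_ : NonZero k}} (s : Vec ℕ k) p .{{_ : NonZero p}}
  (i : Fin (suc p)) (m : I s p) → (m ∈ imΔ s p i) ⇔ (toℕ i ∉ im m)
∈imΔ⇔∉im s (suc p) i m = mk⇔ to from
  where
  to : m ∈ imΔ s (suc p) i → toℕ i ∉ im m
  -- A component of value `i` would be the one value that `punchIn` omits in that factor; `toℕ-↑ˡ`
  -- matches the numerical values.
  to (m′ , Δm′≡m) (a , mₐ≡i) = punchInᵢ≢i (i ↑ˡ excess s a) (m′ a)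
    (trans (Δm′≡m a) (toℕ-injective (trans mₐ≡i (sym (toℕ-↑ˡ i (excess s a))))))

  from : toℕ i ∉ im m → m ∈ imΔ s (suc p) i
  -- A product map can be inverted factor by factor, so the preimage is built componentwise.
  from i∉im = (λ a → punchOut (i≢m a)) , (λ a → punchIn-punchOut (i≢m a))
    where
    i≢m = λ a (i≡mₐ : i ↑ˡ excess s a ≡ m a) →
      i∉im (a , trans (cong toℕ (sym i≡mₐ)) (toℕ-↑ˡ i (excess s a)))

proposition3p8 : ∀ (k : ℕ) .{{_ : NonZero k}} (s : Vec ℕ k) → All NonZero s →
    ∀ (p : ℕ) .{{_ : NonZero p}} (j : Fin (suc p)) (m : I s p) →
    (m ∈ Missing s p j) ⇔ (im m ⊇ F j)
proposition3p8 k s _ p j m = mk⇔ to from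
  where
  open module ImΔ i = Equivalence (∈imΔ⇔∉im s p i m) renaming (to to ∈imΔ⇒∉im; from to ∉im⇒∈imΔ)

  -- Constructively, missingness only refutes `toℕ i ∉ im m`; searching the components with `any?`
  -- makes this positive.
  missing⇒∈im : m ∈ Missing s p j → ∀ i → toℕ i ∈ F j → toℕ i ∈ im m
  missing⇒∈im missing i i∈F with any? (λ a → toℕ (m a) ≟ toℕ i)
  ... | yes i∈im = i∈im
  ... | no  i∉im = contradiction (∉im⇒∈imΔ i i∉im) (missing i i∈F)

  to : m ∈ Missing s p j → im m ⊇ F j
  -- Here `i` is a natural number; the bound contained in `F j` turns it into a face index.
  to missing {i} i∈F@(i≤p , _) = subst (_∈ im m) eq
    (missing⇒∈im missing (fromℕ< (s≤s i≤p)) (subst (_∈ F j) (sym eq) i∈F))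
    where eq = toℕ-fromℕ< (s≤s i≤p)

  from : im m ⊇ F j → m ∈ Missing s p j
  from im⊇F i i∈F m∈imΔ = ∈imΔ⇒∉im i m∈imΔ (im⊇F i∈F)
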